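{- There is an absolute constant $\delta \geq 10^{ -9}$ such that for all sufficiently large integers $c$, there exist finite simple graphs $G,H$ with $\chi(G)\geq (1+\delta)c$, $\chi(H)\geq (1+\delta)c$, and $\chi(G\times H)\leq c$.
   Context: For finite graphs $G$ and $H$, the tensor product $G\times H$ is the graph on vertex set $V(G)\times V(H)$ in which $(g_1,h_1)$ and $(g_2,h_2)$ are adjacent if and only if $g_1\sim g_2$ in $G$ and $h_1\sim h_2$ in $H$. $\chi$ denotes the chromatic number. -}

module Defs where

open import Data.Empty using (⊥-elim)
open import Data.Fin using (Fin; finToFun; funToFin)
open import Data.Fin.Properties using (all?; any?; finToFun-funToFin; *↔×; _≟_)
open import Data.Nat using (ℕ; zero; suc; _≤_; z≤n; s≤s; _*_)
open import Data.Product using (∃; _×_; _,_; proj₁; proj₂)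
open import Data.Product.Function.NonDependent.Propositional using (_×-↔_)
open import Function using (_∘_; Injection; Inverse; _↔_)
open import Function.Construct.Composition using (_↔-∘_)
open import Function.Construct.Symmetry using (↔-sym)
open import Function.Properties.Inverse using (↔⇒↣)
open import Level using (0ℓ)
open import Relation.Binary using (Rel; Decidable; Symmetric; Irreflexive)
open import Relation.Binary.PropositionalEquality
  using (_≡_; _≢_; refl; sym; trans; cong; subst)
open import Relation.Nullary using (Dec; yes; no)
open import Relation.Nullary.Decidable using (map′; ¬?; _→-dec_; _×-dec_)
open import Relation.Unary using (Pred) renaming (Decidable to Decidable₁)

record FiniteGraph : Set₁ where
  field
    Vertex : Set
    order  : ℕ
    finite : Vertex ↔ Fin order
    _~_    : Rel Vertex 0ℓ
    _~?_   : Decidable _~_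
    ~-sym  : Symmetric _~_
    ~-irr  : Irreflexive _≡_ _~_

open FiniteGraph using (Vertex; order)

_⊗_ : FiniteGraph → FiniteGraph → FiniteGraph
G ⊗ H = record
  { Vertex = Vertex G × Vertex H
  ; order  = order G * order H
  ; finite = ↔-sym *↔× ↔-∘ (G.finite ×-↔ H.finite)
  ; _~_    = λ (g₁ , h₁) (g₂ , h₂) → (g₁ G.~ g₂) × (h₁ H.~ h₂)
  ; _~?_   = λ (g₁ , h₁) (g₂ , h₂) → (g₁ G.~? g₂) ×-dec (h₁ H.~? h₂)
  ; ~-sym  = λ (p , q) → G.~-sym p , H.~-sym q
  ; ~-irr  = λ { refl (p , _) → G.~-irr refl p }
  }
  where
  module G = FiniteGraph G
  module H = FiniteGraph H

Proper : (G : FiniteGraph) {k : ℕ} → (Vertex G → Fin k) → Set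
Proper G f = ∀ u v → u ~ v → f u ≢ f v
  where open FiniteGraph G using (_~_)

Colourable : FiniteGraph → ℕ → Set
Colourable G k = ∃ λ (f : Vertex G → Fin k) → Proper G f

module _ (G : FiniteGraph) where
  open FiniteGraph G using (finite; _~_; _~?_; ~-irr)
  open Inverse finite using (to; from; strictlyInverseʳ)

  allVertices? : {P : Pred (Vertex G) 0ℓ} → Decidable₁ P → Dec (∀ v → P v)
  allVertices? {P} P? = map′
    (λ h v → subst P (strictlyInverseʳ v) (h (to v)))
    (λ h i → h (from i))
    (all? (P? ∘ from))

  proper? : ∀ {k} (f : Vertex G → Fin k) → Dec (Proper G f)
  proper? f = allVertices? λ u → allVertices? λ v → (u ~? v) →-dec ¬? (f u ≟ f v)

  colourable? : Decidable₁ (Colourable G)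
  colourable? k = map′
    (λ (i , p) → finToFun i ∘ to , p)
    (λ (f , p) → funToFin (f ∘ from) , λ u v u~v e →
      p u v u~v (trans (sym (decode f u)) (trans e (decode f v))))
    (any? λ i → proper? (finToFun {k} {order G} i ∘ to))
    where
    decode : (f : Vertex G → Fin k) → ∀ u →
             finToFun (funToFin (f ∘ from)) (to u) ≡ f u
    decode f u = trans (finToFun-funToFin (f ∘ from) (to u)) (cong f (strictlyInverseʳ u))

  order-colourable : Colourable G (order G)
  order-colourable = to , λ u v u~v e → ~-irr (Injection.injective (↔⇒↣ finite) e) u~v

least : {P : Pred ℕ 0ℓ} → Decidable₁ P → ∀ n → P n →
        ∃ λ k → P k × (∀ j → P j → k ≤ j)
least P? zero    p = zero , p , λ _ _ → z≤n
least P? (suc n) p with P? zero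
... | yes p₀ = zero , p₀ , λ _ _ → z≤n
... | no ¬p₀ with least (P? ∘ suc) n p
...   | k , pk , min = suc k , pk , λ where
        zero    p₀ → ⊥-elim (¬p₀ p₀)
        (suc j) pj → s≤s (min j pj)

leastColouring : ∀ G → ∃ λ k → Colourable G k × (∀ j → Colourable G j → k ≤ j)
leastColouring G = least (colourable? G) (order G) (order-colourable G)

χ : FiniteGraph → ℕ
χ G = proj₁ (leastColouring G)

χ-colourable : ∀ G → Colourable G (χ G)
χ-colourable G = proj₁ (proj₂ (leastColouring G))

χ-minimal : ∀ G j → Colourable G j → χ G ≤ j
χ-minimal G = proj₂ (proj₂ (leastColouring G))

{-# OPTIONS --safe #-}

-- The graphs are G = B ⊠ K_q, for a triangle-free B, and the exponential graph
-- H = K_c^G, whose vertices are all maps G → [c]; evaluation colours G × H with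
-- c colours.
--
-- Suppose that H is coloured with m colours. Constant maps get distinct colours,
-- so each t ∈ [c] may be identified with the colour of the constant map t, and a
-- map that gets a colour in [c] takes that value. Reserve 2q of the c values and
-- let d be the number of the others. Call such an unreserved t robust at a vertex
-- v of B when some map with unreserved values, constant on the fibres of
-- B ⊠ K_q, gets colour t and takes the value t exactly on the fibre of v.
-- * For t robust at v, the map that is t away from the closed neighbourhood of v
--   and injects the fibres over the neighbourhood into the reserved values is
--   adjacent to that witness, so it does not get colour t. These maps form a
--   clique avoiding d colours, so at most m − d values t are robust at v.
-- * If every v had k·|B| values that are not robust, a system of distinct
--   representatives would give k pairwise adjacent fibre-constant maps with no
--   colour in [c], so k ≤ m − c.
-- Take c/q slightly above 4 and d = c − 2q. If m < c + k, then at some v more than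
-- d − k·|B| values are robust, so m ≥ 2d − k·|B| = 2c − 4q − k·|B|, which is at least
-- c + k for k a small multiple of c; hence m ≥ c + k after all. On the other hand
-- χ(G) ≥ q·|B|/α(B), which exceeds c if |B|/α(B) > 4: the circulant graph on ℤ/35
-- with jumps ±8, ±12, ±14, ±17 is triangle-free with α = 8.

module Submission where

open import Defs
open import Data.Bool using (Bool; true; false; T; not; _∨_; _∧_; if_then_else_)
open import Data.Bool.ListAction using (any)
open import Data.Bool.Properties using (T?; T-∨; T-∧)
open import Data.Empty using (⊥-elim)
open import Data.Fin using (Fin; zero; suc; toℕ; punchIn; splitAt; join; combine; remQuot; finToFun; funToFin)
open import Data.Fin.Properties
  using (_≟_; all?; any?; *↔×; +↔⊎; suc-injective; punchIn-injective; punchInᵢ≢i;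
         injective⇒≤; finToFun-funToFin; combine-injective; remQuot-combine; join-splitAt)
open import Data.Integer using (+_)
import Data.Integer as ℤ
import Data.Integer.Properties as ℤ
open import Data.List using (List; []; _∷_; length; map; filterᵇ; null; allFin; tabulate)
open import Data.List.Properties using (map-tabulate)
open import Data.Nat
  using (ℕ; zero; suc; _≤_; _<_; _^_; _+_; _*_; _∸_; _≤ᵇ_; _≡ᵇ_; z≤n; s≤s)
import Data.Nat as ℕ
import Data.Nat.DivMod as ℕ
import Data.Nat.ListAction as List
open import Data.Nat.Properties hiding (_≟_; suc-injective)
open import Data.Nat.Tactic.RingSolver using (solve-∀)
open import Data.Product using (Σ-syntax; _×_; ∃; _,_; proj₁; proj₂)
open import Data.Rational using (ℚ; _/_; 1ℚ; toℚᵘ) renaming (_≤_ to _≤ℚ_; _+_ to _+ℚ_; _*_ to _*ℚ_)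
import Data.Rational.Properties as ℚ
open import Data.Rational.Properties using (toℚᵘ-cancel-≤; toℚᵘ-homo-*; toℚᵘ-fromℚᵘ)
open import Data.Rational.Unnormalised using (mkℚᵘ; *≤*)
import Data.Rational.Unnormalised as ℚᵘ
import Data.Rational.Unnormalised.Properties as ℚᵘ
open import Data.Sum using (_⊎_; inj₁; inj₂; [_,_]′)
open import Data.Sum.Function.Propositional using (_⊎-↔_)
open import Data.Sum.Properties using (≡-dec; inj₁-injective; inj₂-injective)
open import Data.Unit using (tt)
open import Function using (_∘_; id; const; Injective; Injection; Equivalence; Inverse; _↔_)
open import Function.Construct.Composition using (_↔-∘_)
open import Function.Construct.Identity using (↔-id)
open import Function.Construct.Symmetry using (↔-sym)
open import Function.Properties.Inverse using (↔⇒↣)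
open import Level using (0ℓ)
open import Relation.Binary.PropositionalEquality
  using (_≡_; _≢_; refl; sym; trans; cong; subst; subst₂)
open import Relation.Nullary using (Dec; yes; no; does; ¬_; contradiction)
open import Relation.Nullary.Decidable
  using (decidable-stable; from-yes; ¬?; _×-dec_; _⊎-dec_; _→-dec_)
open import Relation.Unary using (Pred) renaming (Decidable to Decidable₁)

open import Algebra.Properties.CommutativeMonoid.Sum +-0-commutativeMonoid
  using (sum; sum-syntax; ∑-comm; sum-cong-≗)

private variable
  A : Set
  d k l m n : ℕ

-- Injective families

Inj : {A B : Set} → (A → B) → Set
Inj f = Injective _≡_ _≡_ f

AtLeast : ℕ → Pred A 0ℓ → Set
AtLeast {A} k P = Σ[ e ∈ (Fin k → A) ] Inj e × (∀ i → P (e i))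

atLeast-suc : {P : Pred (Fin (suc d)) 0ℓ} → AtLeast k (P ∘ suc) → AtLeast k P
atLeast-suc (e , inj , p) = suc ∘ e , inj ∘ suc-injective , p

atLeast-zero : {P : Pred (Fin (suc d)) 0ℓ} → P zero → AtLeast k (P ∘ suc) → AtLeast (suc k) P
atLeast-zero {d} {k} {P} p₀ (e , inj , p) = e′ , inj′ , p′
  where
  e′ : Fin (suc k) → Fin (suc d)
  e′ zero    = zero
  e′ (suc i) = suc (e i)
  inj′ : Inj e′
  inj′ {zero}  {zero}  _  = refl
  inj′ {suc i} {suc j} eq = cong suc (inj (suc-injective eq))
  p′ : ∀ i → P (e′ i)
  p′ zero    = p₀
  p′ (suc i) = p i

-- Pigeonhole by scanning: each element lowers the demand on one of the two sides by one.
atLeast-split : {P : Pred (Fin d) 0ℓ} → Decidable₁ P → k + l ≤ d →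
                AtLeast k P ⊎ AtLeast l (¬_ ∘ P)
atLeast-split {k = zero} P? _ = inj₁ ((λ ()) , (λ { {()} }) , λ ())
atLeast-split {k = suc _} {l = zero} P? _ = inj₂ ((λ ()) , (λ { {()} }) , λ ())
atLeast-split {suc d} {suc k} {suc l} {P} P? (s≤s le) with P? zero
... | yes p = [ inj₁ ∘ atLeast-zero {P = P} p , inj₂ ∘ atLeast-suc {P = ¬_ ∘ P} ]′
                (atLeast-split {k = k} {P = P ∘ suc} (P? ∘ suc) le)
... | no ¬p = [ inj₁ ∘ atLeast-suc {P = P} , inj₂ ∘ atLeast-zero {P = ¬_ ∘ P} ¬p ]′
                (atLeast-split {P = P ∘ suc} (P? ∘ suc) (subst (_≤ d) (+-suc k l) le))

-- Greedy: the first list gives its first value, and each later list loses one entry so as to avoid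
-- that value, which leaves it exactly long enough.
injective-choice : ∀ n (e : Fin n → Fin n → Fin d) → (∀ i → Inj (e i)) →
                   Σ[ a ∈ (Fin n → Fin d) ] Inj a × (∀ i → ∃ λ x → a i ≡ e i x)
injective-choice zero e inj = (λ ()) , (λ { {()} }) , λ ()
injective-choice {d} (suc n) e inj = a , a-inj , a∈e
  where
  a₀ = e zero zero
  avoid : ∀ i → ∃ λ x → ∀ y → y ≢ x → e (suc i) y ≢ a₀
  avoid i with any? (λ x → e (suc i) x ≟ a₀)
  ... | yes (x , hit) = x , λ y y≢x eq → y≢x (inj (suc i) (trans eq (sym hit)))
  -- If `a₀` is absent any entry may go; dropping one keeps the lists equally long.
  ... | no  miss      = zero , λ y _ eq → miss (y , eq)
  skip : Fin n → Fin (suc n)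
  skip i = proj₁ (avoid i)
  rest = injective-choice n (λ i → e (suc i) ∘ punchIn (skip i))
           (λ i → punchIn-injective (skip i) _ _ ∘ inj (suc i))
  b = proj₁ rest
  b≢a₀ : ∀ i → b i ≢ a₀
  b≢a₀ i eq with proj₂ (proj₂ rest) i
  ... | x , b≡ = proj₂ (avoid i) _ (punchInᵢ≢i (skip i) x) (trans (sym b≡) eq)
  a : Fin (suc n) → Fin d
  a zero    = a₀
  a (suc i) = b i
  a-inj : Inj a
  a-inj {zero}  {zero}  _  = refl
  a-inj {zero}  {suc j} eq = contradiction (sym eq) (b≢a₀ j)
  a-inj {suc i} {zero}  eq = contradiction eq (b≢a₀ i)
  a-inj {suc i} {suc j} eq = cong suc (proj₁ (proj₂ rest) eq)
  a∈e : ∀ i → ∃ λ x → a i ≡ e i x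
  a∈e zero    = zero , refl
  a∈e (suc i) with proj₂ (proj₂ rest) i
  ... | x , b≡ = punchIn (skip i) x , b≡

disjoint-injections : {f : Fin k → Fin m} {g : Fin l → Fin m} → Inj f → Inj g →
                      (∀ i j → f i ≢ g j) → k + l ≤ m
disjoint-injections {k} {m} {l} {f} {g} f-inj g-inj f≢g = injective⇒≤ {f = h ∘ splitAt k} h-inj
  where
  h : Fin k ⊎ Fin l → Fin m
  h = [ f , g ]′
  h-inj⊎ : ∀ x y → h x ≡ h y → x ≡ y
  h-inj⊎ (inj₁ i) (inj₁ j) eq = cong inj₁ (f-inj eq)
  h-inj⊎ (inj₁ i) (inj₂ j) eq = contradiction eq (f≢g i j)
  h-inj⊎ (inj₂ i) (inj₁ j) eq = contradiction (sym eq) (f≢g j i)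
  h-inj⊎ (inj₂ i) (inj₂ j) eq = cong inj₂ (g-inj eq)
  h-inj : Inj (h ∘ splitAt k)
  h-inj {i} {j} eq = trans (sym (join-splitAt k l i))
    (trans (cong (join k l) (h-inj⊎ (splitAt k i) (splitAt k j) eq)) (join-splitAt k l j))

-- Independent sets and colour classes

-- A branching certificate that every independent subset of the list has at most
-- b elements; the first argument of type ℕ is fuel.
fits : (A → A → Bool) → ℕ → ℕ → List A → Bool
fits adj zero    b       L       = false
fits adj (suc f) zero    L       = null L
fits adj (suc f) (suc b) []      = true
fits adj (suc f) (suc b) (v ∷ L) = (length L ≤ᵇ b)
  ∨ (fits adj f b (filterᵇ (not ∘ adj v) L) ∧ fits adj f (suc b) L)

-- The indicator of an independent set, numerical so that the count of a colour in a fibre can serve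
-- directly.
record IndependentWeight (adj : A → A → Bool) (w : A → ℕ) : Set where
  field
    ≤1          : ∀ v → w v ≤ 1
    independent : ∀ u v → T (adj u v) → w u ≡ 0 ⊎ w v ≡ 0

module _ {adj : A → A → Bool} {w : A → ℕ} (W : IndependentWeight adj w) where
  open IndependentWeight W

  weight : List A → ℕ
  weight L = List.sum (map w L)

  weight≤length : ∀ L → weight L ≤ length L
  weight≤length []      = z≤n
  weight≤length (v ∷ L) = +-mono-≤ (≤1 v) (weight≤length L)

  weight-filter : ∀ {v} → w v ≢ 0 → ∀ L → weight L ≡ weight (filterᵇ (not ∘ adj v) L)
  weight-filter         w≢0 []      = refl
  weight-filter {v = v} w≢0 (u ∷ L) with adj v u | independent v u
  ... | false | _     = cong (_+_ (w u)) (weight-filter w≢0 L)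
  ... | true  | indep with indep tt
  ...   | inj₁ w≡0 = contradiction w≡0 w≢0
  ...   | inj₂ w≡0 = trans (cong (_+ weight L) w≡0) (weight-filter w≢0 L)

  fits-sound : ∀ f b L → T (fits adj f b L) → weight L ≤ b
  fits-sound (suc f) zero    []      _ = z≤n
  fits-sound (suc f) (suc b) []      _ = z≤n
  fits-sound (suc f) (suc b) (v ∷ L) p with Equivalence.to T-∨ p
  ... | inj₁ short = +-mono-≤ (≤1 v) (≤-trans (weight≤length L) (≤ᵇ⇒≤ (length L) b short))
  ... | inj₂ branches with Equivalence.to T-∧ branches | w v ℕ.≟ 0
  ...   | _      , absent | yes w≡0 = subst (λ x → x + weight L ≤ suc b) (sym w≡0) (fits-sound f (suc b) L absent)
  ...   | chosen , _      | no  w≢0 = +-mono-≤ (≤1 v)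
            (subst (_≤ b) (sym (weight-filter w≢0 L)) (fits-sound f b _ chosen))

sum-tabulate : (w : Fin n → ℕ) → List.sum (tabulate w) ≡ sum w
sum-tabulate {zero}  w = refl
sum-tabulate {suc n} w = cong (_+_ (w zero)) (sum-tabulate (w ∘ suc))

independent-bound : ∀ f b {adj : Fin n → Fin n → Bool} → T (fits adj f b (allFin n)) →
                    ∀ {w} → IndependentWeight adj w → sum w ≤ b
independent-bound {n} f b ok {w} W = subst (_≤ b)
  (trans (cong List.sum (map-tabulate id w)) (sum-tabulate w)) (fits-sound W f b (allFin n) ok)

sum-const : ∀ n c → ∑[ i < n ] c ≡ n * c
sum-const zero    c = refl
sum-const (suc n) c = cong (_+_ c) (sum-const n c)

sum-≤ : ∀ {c} (f : Fin n → ℕ) → (∀ i → f i ≤ c) → sum f ≤ n * c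
sum-≤ {zero}  f f≤c = z≤n
sum-≤ {suc n} f f≤c = +-mono-≤ (f≤c zero) (sum-≤ (f ∘ suc) (f≤c ∘ suc))

[_] : Dec A → ℕ
[ P? ] = if does P? then 1 else 0

[]-≡0 : (P? : Dec A) → ¬ A → [ P? ] ≡ 0
[]-≡0 (yes p) ¬p = contradiction p ¬p
[]-≡0 (no _)  _  = refl

occurrences-none : (g : Fin n → Fin k) {j : Fin k} → (∀ i → g i ≢ j) → ∑[ i < n ] [ g i ≟ j ] ≡ 0
occurrences-none {n} g g≢j = trans (sum-cong-≗ λ i → []-≡0 (g i ≟ _) (g≢j i)) (trans (sum-const n 0) (*-zeroʳ n))

occurrences-≤1 : (g : Fin n → Fin k) → Inj g → ∀ j → ∑[ i < n ] [ g i ≟ j ] ≤ 1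
occurrences-≤1 {zero}  g inj j = z≤n
occurrences-≤1 {suc n} g inj j with g zero ≟ j
... | no  _    = occurrences-≤1 (g ∘ suc) (suc-injective ∘ inj) j
... | yes refl = ≤-reflexive (cong suc (occurrences-none (g ∘ suc) λ i → (λ ()) ∘ inj {suc i} {zero}))

sum-indicator : (i : Fin k) → ∑[ j < k ] [ i ≟ j ] ≡ 1
sum-indicator {suc k} zero    = cong suc (trans (sum-const k 0) (*-zeroʳ k))
sum-indicator {suc k} (suc i) = sum-indicator i

-- Exponential graphs

module _ (G : FiniteGraph) where
  open FiniteGraph G
  open Inverse finite using (to; from; strictlyInverseʳ)

  ev : Fin (k ^ order) → Vertex → Fin k
  ev i = finToFun i ∘ to

  encode : (Vertex → Fin k) → Fin (k ^ order)
  encode f = funToFin (f ∘ from)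

  ev-encode : (f : Vertex → Fin k) → ∀ u → ev (encode f) u ≡ f u
  ev-encode f u = trans (finToFun-funToFin (f ∘ from) (to u)) (cong f (strictlyInverseʳ u))

  Compatible : (f g : Vertex → A) → Set
  Compatible f g = ∀ u v → u ~ v → f u ≢ g v

  -- A loop at a map would make that map a proper colouring of `G`, so uncolourability gives
  -- irreflexivity.
  exponential : ∀ k → ¬ Colourable G k → FiniteGraph
  exponential k uncolourable = record
    { Vertex = Fin (k ^ order)
    ; order  = k ^ order
    ; finite = ↔-id _
    ; _~_    = λ i j → Compatible (ev i) (ev j)
    ; _~?_   = λ i j → allVertices? G λ u → allVertices? G λ v →
                 (u ~? v) →-dec ¬? (ev i u ≟ ev j v)
    ; ~-sym  = λ p u v u~v eq → p v u (~-sym u~v) (sym eq)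
    ; ~-irr  = λ { {i} refl p → uncolourable (ev i , p) }
    }

  product-exponential-colourable : (h : ¬ Colourable G k) → Colourable (G ⊗ exponential k h) k
  product-exponential-colourable h =
    (λ (u , i) → ev i u) , λ (u , i) (v , j) (u~v , i~j) → i~j u v u~v

  record MapColouring (C : Set) (m : ℕ) : Set where
    field
      colour : (Vertex → C) → Fin m
      proper : ∀ {f g} → Compatible f g → colour f ≢ colour g

  mapColouring : {C : Set} (ι : C → Fin k) → (∀ {x y} → ι x ≡ ι y → x ≡ y) →
                 (h : ¬ Colourable G k) →
                 Colourable (exponential k h) m → MapColouring C m
  mapColouring ι ι-inj h (F , F-proper) = record
    { colour = λ f → F (encode (ι ∘ f))
    ; proper = λ f#g → F-proper _ _ λ u v u~v eq → f#g u v u~v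
        (ι-inj (trans (sym (ev-encode _ u)) (trans eq (ev-encode _ v))))
    }

-- Two reserved blocks of size q, one for a central fibre and one shared by all neighbouring fibres,
-- then d unreserved values.
Palette : ℕ → ℕ → Set
Palette q d = (Fin q ⊎ Fin q) ⊎ Fin d

palette↔ : ∀ {q d} → Fin (q + q + d) ↔ Palette q d
palette↔ = (+↔⊎ ⊎-↔ ↔-id _) ↔-∘ +↔⊎

-- Blow-ups by cliques

module Blowup {n : ℕ} (adj : Fin n → Fin n → Bool)
  (adj-sym : ∀ u v → T (adj u v) → T (adj v u))
  (adj-irr : ∀ u → ¬ T (adj u u)) (q : ℕ) where

  blowup : FiniteGraph
  blowup = record
    { Vertex = Fin n × Fin q
    ; order  = n * q
    ; finite = ↔-sym *↔×
    ; _~_    = λ (u , i) (v , j) → T (adj u v) ⊎ (u ≡ v × i ≢ j)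
    ; _~?_   = λ (u , i) (v , j) → T? (adj u v) ⊎-dec ((u ≟ v) ×-dec ¬? (i ≟ j))
    ; ~-sym  = λ { (inj₁ e) → inj₁ (adj-sym _ _ e) ; (inj₂ (e , ne)) → inj₂ (sym e , ne ∘ sym) }
    ; ~-irr  = λ { refl (inj₁ e) → adj-irr _ e ; refl (inj₂ (_ , ne)) → ne refl }
    }

  open FiniteGraph blowup using (Vertex)

  -- A colour class meets each fibre at most once and projects to an independent set; vertices are
  -- counted by colour.
  order≤colours*α : ∀ {α} → (∀ {w} → IndependentWeight adj w → sum w ≤ α) →
                    Colourable blowup k → n * q ≤ k * α
  order≤colours*α {k} {α} bound (f , proper) = begin
    n * q                                                  ≡⟨ sum-const n q ⟨
    (∑[ v < n ] q)                                         ≡⟨ sum-cong-≗ fibre ⟩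
    (∑[ v < n ] ∑[ j < k ] ∑[ i < q ] [ f (v , i) ≟ j ])   ≡⟨ ∑-comm (λ v j → ∑[ i < q ] [ f (v , i) ≟ j ]) ⟩
    (∑[ j < k ] ∑[ v < n ] ∑[ i < q ] [ f (v , i) ≟ j ])   ≤⟨ sum-≤ _ (λ j → bound (class j)) ⟩
    k * α                                                  ∎
    where
    open ≤-Reasoning
    fibre : ∀ v → q ≡ ∑[ j < k ] ∑[ i < q ] [ f (v , i) ≟ j ]
    fibre v = trans (sym (trans (sum-const q 1) (*-identityʳ q)))
      (trans (sum-cong-≗ {q} λ i → sym (sum-indicator (f (v , i)))) (∑-comm {q} {k} (λ i j → [ f (v , i) ≟ j ])))
    class : ∀ j → IndependentWeight adj (λ v → ∑[ i < q ] [ f (v , i) ≟ j ])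
    class j .IndependentWeight.≤1 v = occurrences-≤1 (λ i → f (v , i)) inj j
      where
      inj : Inj (λ i → f (v , i))
      inj {i} {i′} eq = decidable-stable (i ≟ i′) λ i≢i′ → proper _ _ (inj₂ (refl , i≢i′)) eq
    class j .IndependentWeight.independent u v u~v with any? (λ i → f (u , i) ≟ j)
    ... | no  none       = inj₁ (occurrences-none _ (λ i eq → none (i , eq)))
    ... | yes (i , refl) = inj₂ (occurrences-none _ λ i′ eq → proper (u , i) (v , i′) (inj₁ u~v) (sym eq))

  -- Colourings of the exponential graph of a blow-up

  module Robust (triangle-free : ∀ u v w → T (adj u v) → T (adj v w) → ¬ T (adj u w))
    {d m : ℕ} (Ψ : MapColouring blowup (Palette q d) m) where

    open MapColouring Ψ

    κ : Palette q d → Fin m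
    κ s = colour (const s)

    κ-injective : Inj κ
    κ-injective {s} {t} eq = decidable-stable (≡-dec (≡-dec _≟_ _≟_) _≟_ s t)
      λ s≢t → proper {const s} {const t} (λ _ _ _ → s≢t) eq

    -- A map that omits the value `s` is adjacent to the constant map `s`.
    colour-in-image : ∀ {f s} → colour f ≡ κ s → ¬ (∀ x → f x ≢ s)
    colour-in-image eq avoids = proper (λ u _ _ → avoids u) eq

    Clique : (Fin k → Vertex → Palette q d) → Set
    Clique f = ∀ {i j} → i ≢ j → Compatible blowup (f i) (f j)

    clique-bound : {f : Fin k → Vertex → Palette q d} {S : Fin l → Palette q d} → Clique f → Inj S →
                   (∀ i j → colour (f i) ≢ κ (S j)) → k + l ≤ m
    clique-bound clique S-inj =
      disjoint-injections (λ {i} {j} eq → decidable-stable (i ≟ j) λ i≢j → proper (clique i≢j) eq)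
        (S-inj ∘ κ-injective)

    lift : (Fin n → Fin d) → Vertex → Palette q d
    lift φ (v , _) = inj₂ (φ v)

    Witness : Fin n → Fin d → (Fin n → Fin d) → Set
    Witness v t φ = φ v ≡ t × (∀ w → φ w ≡ t → w ≡ v) × colour (lift φ) ≡ κ (inj₂ t)

    -- Quantifying over codes of maps makes robustness decidable.
    IsRobust : Fin n → Pred (Fin d) 0ℓ
    IsRobust v t = ∃ λ (i : Fin (d ^ n)) → Witness v t (finToFun i)

    isRobust? : ∀ v → Decidable₁ (IsRobust v)
    isRobust? v t = any? λ i → let φ = finToFun i in
      (φ v ≟ t) ×-dec all? (λ w → (φ w ≟ t) →-dec (w ≟ v)) ×-dec (colour (lift φ) ≟ κ (inj₂ t))

    data Zone (v w : Fin n) : Set where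
      centre : w ≡ v → Zone v w
      near   : T (adj v w) → Zone v w
      far    : w ≢ v → ¬ T (adj v w) → Zone v w

    zone : ∀ v w → Zone v w
    zone v w with w ≟ v | T? (adj v w)
    ... | yes w≡v | _        = centre w≡v
    ... | no  _   | yes v~w  = near v~w
    ... | no  w≢v | no  v≁w  = far w≢v v≁w

    paint : ∀ {v w} → Zone v w → Fin d → Fin q → Palette q d
    paint (centre _) _ i = inj₁ (inj₁ i)
    paint (near _)   _ i = inj₁ (inj₂ i)
    paint (far _ _)  t _ = inj₂ t

    μ : Fin n → Fin d → Vertex → Palette q d
    μ v t (w , i) = paint (zone v w) t i

    -- Triangle-freeness makes neighbourhoods independent, so one block of q values suffices for all
    -- fibres over a neighbourhood.
    μ-compatible : ∀ v {s t} → s ≢ t → Compatible blowup (μ v s) (μ v t)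
    μ-compatible v s≢t (w , i) (w′ , i′) e with zone v w | zone v w′ | e
    ... | centre refl | centre refl | inj₁ v~v         = ⊥-elim (adj-irr v v~v)
    ... | centre _    | centre _    | inj₂ (_ , i≢i′)  = i≢i′ ∘ inj₁-injective ∘ inj₁-injective
    ... | near v~w    | near v~w′   | inj₁ w~w′        = ⊥-elim (triangle-free v w w′ v~w w~w′ v~w′)
    ... | near _      | near _      | inj₂ (_ , i≢i′)  = i≢i′ ∘ inj₂-injective ∘ inj₁-injective
    ... | far _ _     | far _ _     | _                = s≢t ∘ inj₂-injective
    ... | centre _    | near _      | _                = λ ()
    ... | centre _    | far _ _     | _                = λ ()
    ... | near _      | centre _    | _                = λ ()
    ... | near _      | far _ _     | _                = λ ()
    ... | far _ _     | centre _    | _                = λ ()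
    ... | far _ _     | near _      | _                = λ ()

    -- `μ v t` is `t` only on far fibres, and none of these is adjacent to the fibre of `v`, the
    -- only place where `lift φ` can be `t`.
    lift-compatible-μ : ∀ v {t φ} → (∀ w → φ w ≡ t → w ≡ v) → Compatible blowup (lift φ) (μ v t)
    lift-compatible-μ v only (w , i) (w′ , i′) e eq with zone v w′ | eq
    ... | far w′≢v v≁w′ | eq′ with only w (inj₂-injective eq′) | e
    ...   | refl | inj₁ v~w′       = v≁w′ v~w′
    ...   | refl | inj₂ (refl , _) = w′≢v refl

    -- By `colour-in-image` the map takes the value `s`; its only unreserved value is `t`, so s = t,
    -- the colour of the adjacent witness.
    μ-colour-robust : ∀ v {t} → IsRobust v t → ∀ s → colour (μ v t) ≢ κ (inj₂ s)
    μ-colour-robust v {t} (c , _ , only , φ-colour) s eq = colour-in-image eq avoids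
      where
      avoids : ∀ x → μ v t x ≢ inj₂ s
      avoids (w , i) hit with zone v w | hit
      ... | far _ _ | refl = proper (lift-compatible-μ v only) (trans φ-colour (sym eq))

    robust-bound : ∀ v → AtLeast l (IsRobust v) → l + d ≤ m
    robust-bound v (g , g-inj , robust) =
      clique-bound {f = μ v ∘ g} {S = inj₂} (λ i≢j → μ-compatible v (i≢j ∘ g-inj))
        inj₂-injective (λ i s → μ-colour-robust v (robust i) s)

    fragile-bound : ∀ k → (∀ v → AtLeast (n * k) (¬_ ∘ IsRobust v)) → k + (q + q + d) ≤ m
    fragile-bound k fragile = clique-bound {f = lift ∘ φ} {S = palette} clique
      (Injection.injective (↔⇒↣ palette↔)) uncoloured
      where
      -- Each vertex owns k of the n·k slots, and each slot lists n·k fragile values of its owner,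
      -- as the greedy choice requires.
      owner : Fin (n * k) → Fin n
      owner = proj₁ ∘ remQuot k
      palette = Inverse.to (palette↔ {q} {d})
      choice = injective-choice (n * k) (proj₁ ∘ fragile ∘ owner) (λ x → proj₁ (proj₂ (fragile (owner x))))
      a : Fin n → Fin k → Fin d
      a v j = proj₁ choice (combine v j)
      a-inj : ∀ {v w i j} → a v i ≡ a w j → v ≡ w × i ≡ j
      a-inj eq = combine-injective _ _ _ _ (proj₁ (proj₂ choice) eq)
      a-fragile : ∀ v j → ¬ IsRobust v (a v j)
      a-fragile v j with proj₂ (proj₂ choice) (combine v j)
      ... | x , eq = subst₂ (λ w t → ¬ IsRobust w t)
        (cong proj₁ (remQuot-combine v j)) (sym eq) (proj₂ (proj₂ (fragile (owner (combine v j)))) x)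
      -- Encoding and decoding makes `φ j` literally the map of a code, as `IsRobust` demands.
      φ : Fin k → Fin n → Fin d
      φ j = finToFun (funToFin λ v → a v j)
      φ≗a : ∀ j v → φ j v ≡ a v j
      φ≗a j = finToFun-funToFin λ v → a v j
      φ-inj : ∀ {v w i j} → φ i v ≡ φ j w → v ≡ w × i ≡ j
      φ-inj eq = a-inj (trans (sym (φ≗a _ _)) (trans eq (φ≗a _ _)))
      clique : Clique (lift ∘ φ)
      clique i≢j _ _ _ eq = i≢j (proj₂ (φ-inj (inj₂-injective eq)))
      uncoloured : ∀ j s → colour (lift (φ j)) ≢ κ (palette s)
      uncoloured j s eq with palette s | eq
      ... | inj₁ _ | eq′ = colour-in-image eq′ (λ _ ())
      ... | inj₂ t | eq′ with any? (λ v → φ j v ≟ t)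
      -- All chosen values differ, so `φ j` is `t` only at `v` and would witness that `t` is robust
      -- there.
      ...   | yes (v , refl) = a-fragile v j (subst (IsRobust v) (φ≗a j v)
                (funToFin (λ v → a v j) , refl , (λ w → proj₁ ∘ φ-inj) , eq′))
      ...   | no  miss       = colour-in-image eq′ λ (v , _) → miss ∘ (v ,_) ∘ inj₂-injective

    -- As m < l + d, no vertex has l robust values, so each has n·k fragile ones.
    colouring-bound : ∀ k l → n * k + l ≤ d → m < l + d → k + (q + q + d) ≤ m
    colouring-bound k l fits-d m< = fragile-bound k λ v →
      [ (λ robust → contradiction (robust-bound v robust) (<⇒≱ m<)) , id ]′
        (atLeast-split (isRobust? v) (subst (_≤ d) (+-comm (n * k) l) fits-d))

-- Numerical parameters

-- The parameters are c = 1000 r + s, q = 230 r, d = 540 r + s and k = 2 r: the ratio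
-- c/q ≈ 1000/230 lies between 4 and 35/8.
colours : ℕ → ℕ → ℕ
colours r s = r * 230 + r * 230 + (r * 540 + s)

base-colours-bound : ∀ r s {x} → 200 ≤ r → s < 1000 →
                     35 * (r * 230) ≤ x * 8 → 1001 * colours r s ≤ 1000 * x
base-colours-bound r s {x} 200≤r s<1000 bound = *-cancelˡ-≤ 8 (begin
  8 * (1001 * colours r s)       ≡⟨ e₁ r s ⟩
  r * 8008000 + 8008 * s         ≤⟨ +-monoʳ-≤ (r * 8008000) (*-monoʳ-≤ 8008 (<⇒≤ s<1000)) ⟩
  r * 8008000 + 200 * 40040      ≤⟨ +-monoʳ-≤ (r * 8008000) (*-monoˡ-≤ 40040 200≤r) ⟩
  r * 8008000 + r * 40040        ≡⟨ sym (*-distribˡ-+ r 8008000 40040) ⟩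
  -- The slack: 35/8 · 230 = 1006.25 exceeds 1001, with room for the remainder `s`.
  r * 8048040                    ≤⟨ *-monoʳ-≤ r (≤ᵇ⇒≤ 8048040 8050000 _) ⟩
  r * 8050000                    ≡⟨ e₂ r ⟩
  1000 * (35 * (r * 230))        ≤⟨ *-monoʳ-≤ 1000 bound ⟩
  1000 * (x * 8)                 ≡⟨ e₃ x ⟩
  8 * (1000 * x)                 ∎)
  where
  open ≤-Reasoning
  e₁ : ∀ r s → 8 * (1001 * (r * 230 + r * 230 + (r * 540 + s))) ≡ r * 8008000 + 8008 * s
  e₁ = solve-∀
  e₂ : ∀ r → r * 8050000 ≡ 1000 * (35 * (r * 230))
  e₂ = solve-∀
  e₃ : ∀ x → 1000 * (x * 8) ≡ 8 * (1000 * x)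
  e₃ = solve-∀

scale-≤ : ∀ c x → 1001 * c ≤ 1000 * x → ((1ℚ +ℚ (+ 1 / 1000)) *ℚ (+ c / 1)) ≤ℚ (+ x / 1)
scale-≤ c x le = toℚᵘ-cancel-≤ (begin
  toℚᵘ ((1ℚ +ℚ (+ 1 / 1000)) *ℚ (+ c / 1))  ≃⟨ toℚᵘ-homo-* (1ℚ +ℚ (+ 1 / 1000)) (+ c / 1) ⟩
  -- `mkℚᵘ` stores the denominator less one, so this factor is 1001/1000.
  mkℚᵘ (+ 1001) 999 ℚᵘ.* toℚᵘ (+ c / 1)     ≃⟨ ℚᵘ.*-congˡ {mkℚᵘ (+ 1001) 999} (toℚᵘ-fromℚᵘ (mkℚᵘ (+ c) 0)) ⟩
  mkℚᵘ (+ 1001) 999 ℚᵘ.* mkℚᵘ (+ c) 0       ≤⟨ *≤* cross ⟩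
  mkℚᵘ (+ x) 0                              ≃⟨ ℚᵘ.≃-sym (toℚᵘ-fromℚᵘ (mkℚᵘ (+ x) 0)) ⟩
  toℚᵘ (+ x / 1)                            ∎)
  where
  open ℚᵘ.≤-Reasoning
  cross : (+ 1001 ℤ.* + c) ℤ.* + 1 ℤ.≤ + x ℤ.* + 1000
  cross = subst₂ ℤ._≤_ (trans (ℤ.pos-* 1001 c) (sym (ℤ.*-identityʳ _)))
    (trans (cong +_ (*-comm 1000 x)) (ℤ.pos-* x 1000)) (ℤ.+≤+ le)

-- Here c/1000 < r + 1 ≤ 2r = k.
excess-colours-bound : ∀ r s {m} → 1 ≤ r → s < 1000 →
                       1000 * m < 1001 * colours r s → m < r * 2 + colours r s
excess-colours-bound r s {m} 1≤r s<1000 m< = *-cancelˡ-< 1000 m (r * 2 + colours r s) (begin-strict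
  1000 * m                                     <⟨ m< ⟩
  1001 * colours r s                           ≡⟨ e r s ⟩
  r * 1001000 + 1000 * s + s                   ≤⟨ +-monoʳ-≤ (r * 1001000 + 1000 * s) (<⇒≤ s<1000) ⟩
  r * 1001000 + 1000 * s + 1 * 1000            ≤⟨ +-monoʳ-≤ (r * 1001000 + 1000 * s) (*-monoˡ-≤ 1000 1≤r) ⟩
  r * 1001000 + 1000 * s + r * 1000            ≡⟨ e′ r s ⟩
  1000 * (r * 2 + colours r s)                 ∎)
  where
  open ≤-Reasoning
  e : ∀ r s → 1001 * (r * 230 + r * 230 + (r * 540 + s)) ≡ r * 1001000 + 1000 * s + s
  e = solve-∀
  e′ : ∀ r s → r * 1001000 + 1000 * s + r * 1000 ≡ 1000 * (r * 2 + (r * 230 + r * 230 + (r * 540 + s)))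
  e′ = solve-∀

-- With l = d - 35k this amounts to c - 4q ≥ 36k, that is 80r + s ≥ 72r; hence the need for c/q > 4.
robust-room : ∀ r s → r * 2 + colours r s ≤ (r * 470 + s) + (r * 540 + s)
robust-room r s = ≤-trans (m≤m+n (r * 2 + colours r s) (r * 8 + s)) (≤-reflexive (e r s))
  where
  e : ∀ r s → r * 2 + (r * 230 + r * 230 + (r * 540 + s)) + (r * 8 + s) ≡ (r * 470 + s) + (r * 540 + s)
  e = solve-∀

split-room : ∀ r s → 35 * (r * 2) + (r * 470 + s) ≡ r * 540 + s
split-room = solve-∀

colours-divMod : ∀ c → colours (c ℕ./ 1000) (c ℕ.% 1000) ≡ c
colours-divMod c = trans (e (c ℕ./ 1000) (c ℕ.% 1000)) (sym (ℕ.m≡m%n+[m/n]*n c 1000))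
  where
  e : ∀ r s → r * 230 + r * 230 + (r * 540 + s) ≡ s + r * 1000
  e = solve-∀

-- The circulant base graph

-- Each jump j comes with 35 - j, because `circulant` tests the absolute difference of
-- representatives.
jumps : List ℕ
jumps = 8 ∷ 12 ∷ 14 ∷ 17 ∷ 18 ∷ 21 ∷ 23 ∷ 27 ∷ []

circulant : Fin 35 → Fin 35 → Bool
circulant u v = any ((toℕ u ∸ toℕ v) + (toℕ v ∸ toℕ u) ≡ᵇ_) jumps

circulant-sym : ∀ u v → T (circulant u v) → T (circulant v u)
circulant-sym u v = subst (λ x → T (any (x ≡ᵇ_) jumps)) (+-comm (toℕ u ∸ toℕ v) (toℕ v ∸ toℕ u))

circulant-irr : ∀ u → ¬ T (circulant u u)
circulant-irr = from-yes (all? λ u → ¬? (T? (circulant u u)))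

circulant-triangle-free : ∀ u v w → T (circulant u v) → T (circulant v w) → ¬ T (circulant u w)
circulant-triangle-free = from-yes (all? λ u → all? λ v → all? λ w →
  T? (circulant u v) →-dec (T? (circulant v w) →-dec ¬? (T? (circulant u w))))

-- Checked by evaluation. Each call drops at least one of 35 entries, and fuel 0 fails even on the
-- empty list, hence fuel 36.
circulant-fits : T (fits circulant 36 8 (allFin 35))
circulant-fits = tt

-- The gap for all large c

Gap : ℚ → ℕ → Set₁
Gap δ c = Σ[ G ∈ FiniteGraph ] Σ[ H ∈ FiniteGraph ]
  (((1ℚ +ℚ δ) *ℚ (+ c / 1)) ≤ℚ (+ (χ G) / 1)) ×
  (((1ℚ +ℚ δ) *ℚ (+ c / 1)) ≤ℚ (+ (χ H) / 1)) ×
  (χ (G ⊗ H) ≤ c)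

module _ (r s : ℕ) (200≤r : 200 ≤ r) (s<1000 : s < 1000) where
  open Blowup circulant circulant-sym circulant-irr (r * 230)

  private
    c = colours r s
    G = blowup

  χG-large : 1001 * c ≤ 1000 * χ G
  χG-large = base-colours-bound r s {χ G} 200≤r s<1000
    (order≤colours*α (independent-bound 36 8 circulant-fits) (χ-colourable G))

  1≤r : 1 ≤ r
  1≤r = ≤-trans (s≤s z≤n) 200≤r

  G-uncolourable : ¬ Colourable G c
  G-uncolourable colouring = <⇒≱ (≤-trans 1≤r r≤c) (+-cancelʳ-≤ (1000 * c) c 0
    (≤-trans χG-large (*-monoʳ-≤ 1000 (χ-minimal G c colouring))))
    where
    r≤c : r ≤ c
    r≤c = ≤-trans (m≤m*n r 230) (≤-trans (m≤m+n _ _) (m≤m+n _ _))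

  private
    H = exponential G c G-uncolourable

  χH-large : 1001 * c ≤ 1000 * χ H
  χH-large = ≮⇒≥ λ small → let few = excess-colours-bound r s {χ H} 1≤r s<1000 small in
    <⇒≱ few (colouring-bound (r * 2) (r * 470 + s) (≤-reflexive (split-room r s))
      (<-≤-trans few (robust-room r s)))
    where
    open Robust circulant-triangle-free
      (mapColouring G (Inverse.from palette↔) (Injection.injective (↔⇒↣ (↔-sym palette↔)))
        G-uncolourable (χ-colourable H))

  gap : Gap (+ 1 / 1000) c
  gap = G , H , scale-≤ c (χ G) χG-large , scale-≤ c (χ H) χH-large ,
    χ-minimal (G ⊗ H) c (product-exponential-colourable G G-uncolourable)

theorem1 : Σ[ δ ∈ ℚ ] ((+ 1 / (10 ^ 9)) ≤ℚ δ) ×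
    (Σ[ c₀ ∈ ℕ ] ((c : ℕ) → c₀ ≤ c →
    Σ[ G ∈ FiniteGraph ] Σ[ H ∈ FiniteGraph ]
    (((1ℚ +ℚ δ) *ℚ (+ c / 1)) ≤ℚ (+ (χ G) / 1)) ×
    (((1ℚ +ℚ δ) *ℚ (+ c / 1)) ≤ℚ (+ (χ H) / 1)) ×
    (χ (G ⊗ H) ≤ c)))
-- The threshold 200000 makes the quotient r of c by 1000 at least 200.
theorem1 = + 1 / 1000 , from-yes (+ 1 / (10 ^ 9) ℚ.≤? + 1 / 1000) , 200000 , λ c large →
  subst (Gap (+ 1 / 1000)) (colours-divMod c)
    (gap (c ℕ./ 1000) (c ℕ.% 1000) (ℕ./-monoˡ-≤ 1000 large) (ℕ.m%n<n c 1000))
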